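{- Let $Q=(q_1,\ldots,q_k)$ be an instance of the FIFO stack-up problem and $p$ a positive integer. If the sequence graph $G_Q$ has a directed path-decomposition of width $p-1$, then there is a processing of $Q$ with $p$ stack-up places, i.e. a processing in which every configuration has at most $p$ open pallets.
   Context: A bin $b$ carries a pallet symbol $\mathit{plt}(b)$ (a positive integer). An instance is a list $Q=(q_1,\ldots,q_k)$ of finite sequences of bins, all bins pairwise distinct; it is assumed that for every pallet symbol occurring, the sequences together contain at least two bins destined for it. $\mathit{plts}(Q)$ is the set of pallet symbols occurring in $Q$. A subsequence of $q=(b_1,\ldots,b_n)$ is a suffix $q'=(b_j,\ldots,b_n)$ (possibly empty), and $q-q'=(b_1,\ldots,b_{j-1})$. A configuration is a pair $(Q,Q')$ with $Q'=(q'_1,\ldots,q'_k)$, each $q'_j$ a subsequence of $q_j$. A pallet $t$ is open in $(Q,Q')$ if some bin for $t$ lies in some $q'_i$ and some bin for $t$ lies in some $q_j-q'_j$. A transformation step removes the first bin of one nonempty $q'_i$. A processing of $Q$ is a sequence of transformation steps transforming $(Q,Q)$ into the configuration where all $k$ sequences are empty. The sequence graph $G_Q$ has vertex set $\mathit{plts}(Q)$ and an arc $(u,v)$ iff $u\ne v$ and some sequence $q_i$ contains a bin for $u$ at a position strictly before a bin for $v$. A directed path-decomposition of a digraph $G=(V,E)$ is a sequence $(X_1,\ldots,X_r)$ of subsets of $V$ with: (1) $\bigcup_i X_i=V$; (2) for every arc $(u,v)$ there are $i\le j$ with $u\in X_i$, $v\in X_j$; (3) if $u\in X_i\cap X_j$,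 $i\le j$, then $u\in X_l$ for all $i\le l\le j$. Its width is $\max_i|X_i|-1$. -}

module Defs where

open import Data.Fin as Fin using (Fin)
import Data.Fin.Properties as Fin
open import Data.Integer as ℤ using (ℤ; +_)
open import Data.List using (List; []; _∷_; _++_; length; map; filter; concat; tabulate; lookup; deduplicate)
open import Data.List.Membership.Propositional using (_∈_)
open import Data.List.Membership.Propositional.Properties using (∈-lookup; ∈-map⁺; ∈-concat⁺′; ∈-tabulate⁺; ∈-deduplicate⁺)
open import Data.List.Relation.Unary.All using (All)
open import Data.List.Relation.Unary.Any using (Any; any?)
open import Data.List.Relation.Unary.Unique.Propositional using (Unique)
open import Data.List.Relation.Unary.Unique.DecPropositional.Properties using (deduplicate-!)
open import Data.Nat using (ℕ; suc; _≤_; _⊔_; _≟_; NonZero)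
open import Data.Product using (Σ-syntax; ∃-syntax; _×_; _,_)
import Data.Vec.Functional as Vector
open import Relation.Binary.Construct.Closure.ReflexiveTransitive using (Star; ε; _◅_)
open import Relation.Binary.PropositionalEquality using (_≡_; _≢_; refl)
open import Relation.Nullary using (Dec; _×-dec_)

record FinSet (A : Set) : Set where
  field
    elements : List A
    unique   : Unique elements

open FinSet public

infix 4 _∈ˢ_
_∈ˢ_ : {A : Set} → A → FinSet A → Set
x ∈ˢ X = x ∈ elements X

card : {A : Set} → FinSet A → ℕ
card X = length (elements X)

record Digraph (A : Set) : Set₁ where
  field
    vertices : FinSet A
    Arc      : A → A → Set
    arc-ends : ∀ {u v} → Arc u v → u ∈ˢ vertices × v ∈ˢ vertices

record DirectedPathDecomposition {A : Set} (G : Digraph A) : Set where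
  open Digraph G
  field
    -- The sequence has suc r bags, so that the maximum in the width is
    -- never taken over an empty sequence.
    r         : ℕ
    X         : Fin (suc r) → FinSet A
    X⊆V       : ∀ i {u} → u ∈ˢ X i → u ∈ˢ vertices
    covers    : ∀ {u} → u ∈ˢ vertices → ∃[ i ] u ∈ˢ X i
    arcs      : ∀ {u v} → Arc u v →
                ∃[ i ] ∃[ j ] i Fin.≤ j × u ∈ˢ X i × v ∈ˢ X j
    connected : ∀ {u} i j l → u ∈ˢ X i → u ∈ˢ X j →
                i Fin.≤ l → l Fin.≤ j → u ∈ˢ X l

  -- An integer, since the width is -1 when all bags are empty.
  width : ℤ
  width = + Vector.foldr _⊔_ 0 (λ i → card (X i)) ℤ.- + 1

record Instance : Set₁ where
  field
    Bin     : Set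
    plt     : Bin → ℕ
    plt-pos : ∀ b → NonZero (plt b)
    k       : ℕ
    q       : Fin k → List Bin

  bins : List Bin
  bins = concat (tabulate q)

  pltSet : FinSet ℕ
  pltSet = record
    { elements = deduplicate _≟_ (map plt bins)
    ; unique   = deduplicate-! _≟_ (map plt bins)
    }

  field
    distinct : Unique bins
    two-bins : ∀ {t} → t ∈ˢ pltSet →
               ∃[ b ] ∃[ b′ ] b ≢ b′ × b ∈ bins × b′ ∈ bins × plt b ≡ t × plt b′ ≡ t

module _ (Q : Instance) where
  open Instance Q

  SeqArc : ℕ → ℕ → Set
  SeqArc u v = u ≢ v ×
    ∃[ i ] Σ[ m ∈ Fin (length (q i)) ] Σ[ n ∈ Fin (length (q i)) ]
      m Fin.< n × plt (lookup (q i) m) ≡ u × plt (lookup (q i) n) ≡ v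

  private
    plt-lookup∈ : ∀ i (m : Fin (length (q i))) → plt (lookup (q i) m) ∈ˢ pltSet
    plt-lookup∈ i m =
      ∈-deduplicate⁺ _≟_ (∈-map⁺ plt (∈-concat⁺′ (∈-lookup {xs = q i} m) (∈-tabulate⁺ i)))

  sequenceGraph : Digraph ℕ
  sequenceGraph = record
    { vertices = pltSet
    ; Arc      = SeqArc
    ; arc-ends = λ { (_ , i , m , n , _ , refl , refl) → plt-lookup∈ i m , plt-lookup∈ i n }
    }

  -- In the notation of configurations (Q , Q′): remaining i is the
  -- suffix q′ᵢ and removed i is qᵢ - q′ᵢ.
  record Configuration : Set where
    field
      removed   : Fin k → List Bin
      remaining : Fin k → List Bin
      split     : ∀ i → removed i ++ remaining i ≡ q i

  open Configuration

  initial : Configuration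
  initial = record { removed = λ _ → [] ; remaining = q ; split = λ _ → refl }

  Final : Configuration → Set
  Final c = ∀ i → remaining c i ≡ []

  Step : Configuration → Configuration → Set
  Step c c′ = ∃[ i ] ∃[ b ]
    remaining c i ≡ b ∷ remaining c′ i ×
    (∀ j → j ≢ i → remaining c′ j ≡ remaining c j)

  HasBinFor : ℕ → List Bin → Set
  HasBinFor t = Any (λ b → plt b ≡ t)

  Open : Configuration → ℕ → Set
  Open c t = (∃[ i ] HasBinFor t (remaining c i)) × (∃[ j ] HasBinFor t (removed c j))

  open? : ∀ c t → Dec (Open c t)
  open? c t = Fin.any? (λ i → any? (λ b → plt b ≟ t) (remaining c i))
        ×-dec Fin.any? (λ j → any? (λ b → plt b ≟ t) (removed c j))

  numOpen : Configuration → ℕ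
  numOpen c = length (filter (open? c) (elements pltSet))

  record Processing : Set where
    field
      {last} : Configuration
      steps  : Star Step initial last
      final  : Final last

  visited : ∀ {c d} → Star Step c d → List Configuration
  visited {c} ε        = c ∷ []
  visited {c} (_ ◅ ss) = c ∷ visited ss

  WithPlaces : ℕ → Processing → Set
  WithPlaces p π = All (λ c → numOpen c ≤ p) (visited (Processing.steps π))

{-# OPTIONS --safe #-}
-- Call a pallet entered at stage i if it lies in some bag X j with j ≤ i, and
-- unfinished at stage i if it lies in some X j with i ≤ j; by connectedness a
-- pallet that is both lies in X i. At stage i, keep removing front bins whose
-- pallet is entered, and pass to stage i + 1 when there are none left. Removed
-- bins then have entered pallets and remaining bins unfinished ones, so every
-- open pallet lies in X i, and there are at most p of them. The second half of
-- the invariant survives a change of stage: every sequence that is not empty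
-- then starts with a bin whose pallet u has not been entered, and a bin for
-- v ≢ u behind it gives an arc (u , v), hence bags X j ∋ u and X j′ ∋ v with
-- i < j ≤ j′.
module Submission where

open import Defs
open import Data.Fin as Fin using (Fin; zero; suc; toℕ; fromℕ<; punchIn)
import Data.Fin.Properties as Fin
open import Data.Integer using (+_; _-_; -1ℤ)
import Data.Integer.Properties as ℤ
open import Data.List using (List; []; _∷_; _++_; _∷ʳ_; head; length; lookup)
open import Data.List.Properties using (++-assoc; length-++-sucʳ)
open import Data.List.Membership.Propositional using (_∈_; find)
open import Data.List.Membership.Propositional.Properties
open import Data.List.Relation.Binary.Subset.Propositional using (_⊆_)
open import Data.List.Relation.Unary.All as All using (All; []; _∷_)
open import Data.List.Relation.Unary.AllPairs using ([]; _∷_)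
open import Data.List.Relation.Unary.Any using (here; there; index)
open import Data.List.Relation.Unary.Any.Properties using (lookup-index)
open import Data.List.Relation.Unary.Unique.Propositional using (Unique)
open import Data.List.Relation.Unary.Unique.Propositional.Properties using (filter⁺)
open import Data.Maybe.Relation.Unary.Any as Maybe using (just)
open import Data.Nat using (ℕ; zero; suc; _+_; _≤_; _<_; _⊔_; _≟_; _≤?_; z≤n; s≤s; NonZero)
open import Data.Nat.Properties
open import Data.Product using (Σ-syntax; ∃-syntax; _×_; _,_; proj₂)
open import Data.Sum using (inj₁; inj₂)
open import Data.Vec.Functional using (Vector; foldr; updateAt; removeAt)
open import Data.Vec.Functional.Properties using (updateAt-updates; updateAt-minimal)
open import Function using (_∘_)
open import Relation.Binary.Construct.Closure.ReflexiveTransitive using (Star; ε; _◅_)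
open import Relation.Binary.PropositionalEquality
open import Relation.Nullary using (Dec; yes; no; ¬_; _×-dec_; contradiction)
open import Algebra.Properties.CommutativeMonoid.Sum +-0-commutativeMonoid
  using (sum; sum-remove; sum-cong-≗)
open import Algebra.Properties.AbelianGroup ℤ.+-0-abelianGroup using (∙-cancelʳ)
open import Data.List.Membership.DecPropositional _≟_ using (_∈?_)

-- Lists and finite sums.

Unique-⊆⇒length-≤ : {A : Set} {xs ys : List A} →
                    Unique xs → xs ⊆ ys → length xs ≤ length ys
Unique-⊆⇒length-≤ [] _ = z≤n
Unique-⊆⇒length-≤ {xs = x ∷ xs} (x≢xs ∷ xs!) xs⊆ys
  -- Deleting this occurrence of `x` from `ys` leaves `as ++ bs`, one shorter, which still contains
  -- `xs` because `x` does not recur there.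
  with as , bs , refl ← ∈-∃++ (xs⊆ys (here refl))
  = subst (suc (length xs) ≤_) (sym (length-++-sucʳ as x bs))
      (s≤s (Unique-⊆⇒length-≤ xs! λ z∈xs →
        drop-x (≢-sym (All.lookup x≢xs z∈xs)) (∈-++⁻ as (xs⊆ys (there z∈xs)))))
  where
  drop-x : ∀ {z} → z ≢ x → _ → z ∈ as ++ bs
  drop-x z≢x (inj₁ z∈as)         = ∈-++⁺ˡ z∈as
  drop-x z≢x (inj₂ (here z≡x))   = contradiction z≡x z≢x
  drop-x z≢x (inj₂ (there z∈bs)) = ∈-++⁺ʳ as z∈bs

≤-foldr-⊔ : ∀ {n} (f : Vector ℕ n) i → f i ≤ foldr _⊔_ 0 f
≤-foldr-⊔ f zero    = m≤m⊔n (f zero) _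
≤-foldr-⊔ f (suc i) = ≤-trans (≤-foldr-⊔ (f ∘ suc) i) (m≤n⊔m (f zero) _)

-- Pulling the term at `i` out of both sums leaves equal remainders.
sum-suc-at : ∀ {n} {f g : Vector ℕ n} i → f i ≡ suc (g i) →
             (∀ j → j ≢ i → g j ≡ f j) → sum f ≡ suc (sum g)
sum-suc-at {suc n} {f} {g} i fi≡1+gi g≗f = begin
  sum f                          ≡⟨ sum-remove f ⟩
  f i + sum (removeAt f i)       ≡⟨ cong₂ _+_ fi≡1+gi (sum-cong-≗ λ j →
                                      sym (g≗f (punchIn i j) (Fin.punchInᵢ≢i i j))) ⟩
  suc (g i + sum (removeAt g i)) ≡⟨ cong suc (sum-remove g) ⟨
  suc (sum g)                    ∎
  where open ≡-Reasoning

-- Turns the split of a sequence at its current front bin into the two positions that `SeqArc` asks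
-- for.
positions-++-∷ : {A : Set} (xs : List A) {a b : A} {ys zs : List A} →
                 xs ++ a ∷ ys ≡ zs → b ∈ ys →
                 Σ[ m ∈ Fin (length zs) ] Σ[ n ∈ Fin (length zs) ]
                   m Fin.< n × lookup zs m ≡ a × lookup zs n ≡ b
positions-++-∷ []       refl b∈ys =
  zero , suc (index b∈ys) , s≤s z≤n , refl , sym (lookup-index b∈ys)
positions-++-∷ (x ∷ xs) refl b∈ys with positions-++-∷ xs refl b∈ys
... | m , n , m<n , eq , eq′ = suc m , suc n , s≤s m<n , eq , eq′

-- Removing the first bin of a sequence.

module _ (Q : Instance) where
  open Instance Q
  open Configuration

  plt∈pltSet : ∀ j {b} → b ∈ q j → plt b ∈ˢ pltSet
  plt∈pltSet j b∈q =
    ∈-deduplicate⁺ _≟_ (∈-map⁺ plt (∈-concat⁺′ b∈q (∈-tabulate⁺ j)))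

  remaining⊆q : (c : Configuration Q) → ∀ j → remaining c j ⊆ q j
  remaining⊆q c j b∈ = subst (_ ∈_) (split c j) (∈-++⁺ʳ (removed c j) b∈)

  module _ (c : Configuration Q) (i : Fin k) {b : Bin} {bs : List Bin}
           (front : remaining c i ≡ b ∷ bs) where

    private
      removed′ remaining′ : Fin k → List Bin
      removed′   = updateAt (removed c) i (_∷ʳ b)
      remaining′ = updateAt (remaining c) i (λ _ → bs)

      split′ : ∀ j → removed′ j ++ remaining′ j ≡ q j
      split′ j with j Fin.≟ i
      ... | no j≢i = trans
        (cong₂ _++_ (updateAt-minimal j i (removed c) j≢i) (updateAt-minimal j i (remaining c) j≢i))
        (split c j)
      ... | yes refl = begin
        removed′ j ++ remaining′ j   ≡⟨ cong₂ _++_ (updateAt-updates j (removed c))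
                                                   (updateAt-updates j (remaining c)) ⟩
        (removed c j ∷ʳ b) ++ bs     ≡⟨ ++-assoc (removed c j) (b ∷ []) bs ⟩
        removed c j ++ b ∷ bs        ≡⟨ cong (removed c j ++_) front ⟨
        removed c j ++ remaining c j ≡⟨ split c j ⟩
        q j                          ∎
        where open ≡-Reasoning

    removeFront : Configuration Q
    removeFront = record { removed = removed′ ; remaining = remaining′ ; split = split′ }

    remaining-removeFront : remaining c i ≡ b ∷ remaining removeFront i
    remaining-removeFront =
      trans front (cong (b ∷_) (sym (updateAt-updates i (remaining c))))

    remaining-removeFront-≢ : ∀ j → j ≢ i → remaining removeFront j ≡ remaining c j
    remaining-removeFront-≢ j = updateAt-minimal j i (remaining c)

    step-removeFront : Step Q c removeFront
    step-removeFront = i , b , remaining-removeFront , remaining-removeFront-≢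

    remaining-removeFront-⊆ : ∀ j → remaining removeFront j ⊆ remaining c j
    remaining-removeFront-⊆ j with j Fin.≟ i
    ... | yes refl = subst (_ ∈_) (sym remaining-removeFront) ∘ there
    ... | no j≢i   = subst (_ ∈_) (remaining-removeFront-≢ j j≢i)

    removed-removeFront : (P : Bin → Set) → P b → (∀ j {a} → a ∈ removed c j → P a) →
                          ∀ j {a} → a ∈ removed removeFront j → P a
    removed-removeFront P Pb P-removed j a∈ with j Fin.≟ i
    ... | no j≢i =
      P-removed j (subst (_ ∈_) (updateAt-minimal j i (removed c) j≢i) a∈)
    ... | yes refl
      with ∈-++⁻ (removed c i) (subst (_ ∈_) (updateAt-updates i (removed c)) a∈)
    ...   | inj₁ a∈removed   = P-removed i a∈removed
    ...   | inj₂ (here refl) = Pb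

  binsLeft : Configuration Q → ℕ
  binsLeft c = sum (length ∘ remaining c)

  binsLeft-removeFront : ∀ c i {b bs} (front : remaining c i ≡ b ∷ bs) →
                         binsLeft c ≡ suc (binsLeft (removeFront c i front))
  binsLeft-removeFront c i front = sum-suc-at i
    (cong length (remaining-removeFront c i front))
    (λ j j≢i → cong length (remaining-removeFront-≢ c i front j j≢i))

  -- Stages of a directed path-decomposition.

  module _ (D : DirectedPathDecomposition (sequenceGraph Q)) where
    open DirectedPathDecomposition D

    width≡p-1⇒card≤p : ∀ {p} → width ≡ + p - + 1 → ∀ i → card (X i) ≤ p
    width≡p-1⇒card≤p width≡p-1 i = subst (card (X i) ≤_)
      -- Both sides of `width≡p-1` are integers with 1 subtracted; cancelling it makes `p` the
      -- largest bag size.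
      (ℤ.+-injective (∙-cancelʳ -1ℤ _ _ width≡p-1))
      (≤-foldr-⊔ (card ∘ X) i)

    -- Stages are natural numbers rather than elements of `Fin (suc r)`, so that stage `suc i` can
    -- be named without a bound.
    Entered Unfinished : ℕ → ℕ → Set
    Entered    i t = ∃[ j ] toℕ j ≤ i × t ∈ˢ X j
    Unfinished i t = ∃[ j ] i ≤ toℕ j × t ∈ˢ X j

    entered? : ∀ i t → Dec (Entered i t)
    entered? i t = Fin.any? λ j → (toℕ j ≤? i) ×-dec (t ∈? elements (X j))

    entered∧unfinished⇒∈X : ∀ i {t} → Entered (toℕ i) t → Unfinished (toℕ i) t → t ∈ˢ X i
    entered∧unfinished⇒∈X i (j , j≤i , t∈Xj) (l , i≤l , t∈Xl) =
      connected j l i t∈Xj t∈Xl j≤i i≤l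

    -- An empty sequence has head `nothing` and so is never ready.
    Ready : ℕ → List Bin → Set
    Ready i = Maybe.Any (Entered i ∘ plt) ∘ head

    ready? : ∀ i bs → Dec (Ready i bs)
    ready? i = Maybe.dec (entered? i ∘ plt) ∘ head

    -- Every pallet lies in some bag, and no bag has an index above `r`, so from stage `r` on any
    -- front bin has an entered pallet.
    unready-last⇒[] : ∀ c j {i} → r ≤ i → ¬ Ready i (remaining c j) → remaining c j ≡ []
    unready-last⇒[] c j r≤i unready with remaining c j | remaining⊆q c j
    ... | []    | _    = refl
    ... | b ∷ _ | rem⊆ with l , b∈Xl ← covers (plt∈pltSet j (rem⊆ (here refl))) =
      contradiction (just (l , ≤-trans (Fin.toℕ≤pred[n] l) r≤i , b∈Xl)) unready

    unready⇒unfinished : ∀ c j {i} → ¬ Ready i (remaining c j) →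
                         ∀ {b} → b ∈ remaining c j → Unfinished (suc i) (plt b)
    unready⇒unfinished c j {i} unready {b} b∈
      with remaining c j | remaining⊆q c j | split c j
    ... | a ∷ as | rem⊆ | split-j = unfinished-at b∈
      where
      a-later : ∀ {l} → plt a ∈ˢ X l → i < toℕ l
      a-later a∈Xl = ≰⇒> λ l≤i → unready (just (_ , l≤i , a∈Xl))

      a-unfinished : Unfinished (suc i) (plt a)
      a-unfinished with l , a∈Xl ← covers (plt∈pltSet j (rem⊆ (here refl))) =
        l , a-later a∈Xl , a∈Xl

      unfinished-at : b ∈ a ∷ as → Unfinished (suc i) (plt b)
      unfinished-at (here refl) = a-unfinished
      -- Arcs join distinct pallets only, so a later bin for the pallet of `a` needs a case of its
      -- own.
      unfinished-at (there b∈as) with plt a ≟ plt b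
      ... | yes a≡b = subst (Unfinished (suc i)) a≡b a-unfinished
      ... | no  a≢b
        with m , n , m<n , eq , eq′ ← positions-++-∷ (removed c j) split-j b∈as
        with l , l′ , l≤l′ , a∈Xl , b∈Xl′ ←
               arcs (a≢b , j , m , n , m<n , cong plt eq , cong plt eq′)
        = l′ , ≤-trans (a-later a∈Xl) l≤l′ , b∈Xl′

    -- The invariant along the stages.

    record Invariant (i : ℕ) (c : Configuration Q) : Set where
      field
        entered    : ∀ j {b} → b ∈ removed c j → Entered i (plt b)
        unfinished : ∀ j {b} → b ∈ remaining c j → Unfinished i (plt b)
    open Invariant

    invariant-initial : Invariant 0 (initial Q)
    invariant-initial .entered    j ()
    invariant-initial .unfinished j b∈
      with l , b∈Xl ← covers (plt∈pltSet j b∈) = l , z≤n , b∈Xl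

    invariant-removeFront : ∀ {i} c j {b bs} (front : remaining c j ≡ b ∷ bs) →
                            Entered i (plt b) → Invariant i c →
                            Invariant i (removeFront c j front)
    invariant-removeFront {i} c j front b-entered inv .entered =
      removed-removeFront c j front (Entered i ∘ plt) b-entered (entered inv)
    invariant-removeFront c j front _ inv .unfinished l =
      unfinished inv l ∘ remaining-removeFront-⊆ c j front l

    invariant-suc : ∀ {i c} → (∀ j → ¬ Ready i (remaining c j)) →
                    Invariant i c → Invariant (suc i) c
    invariant-suc unready inv .entered j b∈
      with l , l≤i , b∈Xl ← entered inv j b∈ = l , m≤n⇒m≤1+n l≤i , b∈Xl
    invariant-suc {c = c} unready inv .unfinished j =
      unready⇒unfinished c j (unready j)

    -- The greedy processing.

    module _ {p : ℕ} (card≤p : ∀ i → card (X i) ≤ p) where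

      open⇒∈X : ∀ i {c t} → Invariant (toℕ i) c → Open Q c t → t ∈ˢ X i
      open⇒∈X i inv ((j , remaining-t) , (l , removed-t))
        with _ , b∈ , refl ← find remaining-t | _ , a∈ , a≡t ← find removed-t =
        entered∧unfinished⇒∈X i (subst (Entered _) a≡t (entered inv l a∈)) (unfinished inv j b∈)

      numOpen≤p : ∀ {i c} → i ≤ r → Invariant i c → numOpen Q c ≤ p
      numOpen≤p {c = c} i≤r inv = ≤-trans
        (Unique-⊆⇒length-≤ (filter⁺ (open? Q c) (unique pltSet))
          (open⇒∈X j inv′ ∘ proj₂ ∘ ∈-filter⁻ (open? Q c) {xs = elements pltSet}))
        (card≤p j)
        where
        -- There are `suc r` bags, so a stage `i ≤ r` is the index of one.
        j    = fromℕ< (s≤s i≤r)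
        inv′ = subst (λ i → Invariant i c) (sym (Fin.toℕ-fromℕ< (s≤s i≤r))) inv

      -- Here `f` counts the stages still to come and `n` the bins left. Each recursive call lowers
      -- one of them and keeps the other, which gives termination.
      process : ∀ f n {i c} → f + i ≡ r → binsLeft c ≡ n → Invariant i c →
                ∃[ d ] Σ[ ss ∈ Star (Step Q) c d ]
                  Final Q d × All (λ c′ → numOpen Q c′ ≤ p) (visited Q ss)
      process f n {i} {c} f+i≡r left inv with Fin.any? (λ j → ready? i (remaining c j))
      process zero n {i} {c} refl left inv | no unready =
        c , ε , (λ j → unready-last⇒[] c j ≤-refl (unready ∘ (j ,_))) , numOpen≤p ≤-refl inv ∷ []
      -- A change of stage removes no bin: the configuration stays the same and no step is added.
      process (suc f) n {i} f+i≡r left inv | no unready =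
        process f n (trans (+-suc f i) f+i≡r) left
          (invariant-suc (λ j → unready ∘ (j ,_)) inv)
      process f n {i} {c} f+i≡r left inv | yes (j , ready) with remaining c j in front
      -- A front bin exists, so the number of bins left cannot be zero.
      process f zero {i} {c} f+i≡r left inv | yes (j , just b-entered) | b ∷ bs =
        contradiction (trans (sym left) (binsLeft-removeFront c j front)) λ ()
      process f (suc n) {i} {c} f+i≡r left inv | yes (j , just b-entered) | b ∷ bs
        with d , ss , final , bounded ← process f n f+i≡r
               (suc-injective (trans (sym (binsLeft-removeFront c j front)) left))
               (invariant-removeFront c j front b-entered inv)
        = d , step-removeFront c j front ◅ ss , final ,
          numOpen≤p (m+n≤o⇒n≤o f (≤-reflexive f+i≡r)) inv ∷ bounded

theorem2 : (Q : Instance) (p : ℕ) → .{{_ : NonZero p}} →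
    (D : DirectedPathDecomposition (sequenceGraph Q)) →
    DirectedPathDecomposition.width D ≡ + p - + 1 →
    Σ[ π ∈ Processing Q ] WithPlaces Q p π
theorem2 Q p D width≡p-1
  with d , ss , final , bounded ←
         -- At stage 0 there are `r` stages to come, and every bin is left.
         process Q D (width≡p-1⇒card≤p Q D width≡p-1) _ _ (+-identityʳ _) refl
           (invariant-initial Q D)
  = record { steps = ss ; final = final } , bounded
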